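{- Let $G$ be a $2$-Engel group, i.e. $[x,y,y]=1$ for all $x,y\in G$. If the set $\{x\in G:x^3=1\}$ is $2$-large in $G$, then $G$ has exponent $3$.
   Context: $[x,y]=x^{ -1}y^{ -1}xy$ and $[x,y,z]=[[x,y],z]$. A subset $X\subseteq G$ is $2$-large in $G$ if $aX\cap bX\ne\emptyset$ for all $a,b\in G$. -}

module Defs where

open import Algebra.Bundles using (Group)
open import Data.Nat.Base using (ℕ)
open import Data.Product.Base using (∃; _×_)
open import Level using (_⊔_)
open import Relation.Unary using (Pred; _∈_; _∩_; Satisfiable)
import Algebra.Properties.Monoid.Mult as Mult

module _ {c ℓ} (G : Group c ℓ) where
  open Group G

  infixl 8 _^_
  _^_ : Carrier → ℕ → Carrier
  x ^ n = Mult._×_ monoid n x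

  [_,_] : Carrier → Carrier → Carrier
  [ x , y ] = x ⁻¹ ∙ y ⁻¹ ∙ x ∙ y

  [_,_,_] : Carrier → Carrier → Carrier → Carrier
  [ x , y , z ] = [ [ x , y ] , z ]

  Is2Engel : Set (c ⊔ ℓ)
  Is2Engel = ∀ x y → [ x , y , y ] ≈ ε

  LeftTranslate : ∀ {p} → Carrier → Pred Carrier p → Pred Carrier (c ⊔ ℓ ⊔ p)
  LeftTranslate a X y = ∃ λ x → x ∈ X × y ≈ a ∙ x

  -- "Nonempty" is read as "inhabited".
  Is2Large : ∀ {p} → Pred Carrier p → Set (c ⊔ ℓ ⊔ p)
  Is2Large X = ∀ a b → Satisfiable (LeftTranslate a X ∩ LeftTranslate b X)

  KilledBy : ℕ → Pred Carrier ℓ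
  KilledBy n x = x ^ n ≈ ε

  -- The law xⁿ = 1, not minimality of n: the trivial group has every exponent.
  HasExponent : ℕ → Set (c ⊔ ℓ)
  HasExponent n = ∀ x → x ^ n ≈ ε

{-# OPTIONS --safe #-}

-- Two-largeness, applied to the translates by g and 1, writes g as a product
-- of two elements a, b of order dividing 3. The 2-Engel law makes [ b , a ]
-- commute with both a and b, so (ab)³ = a³ b³ [ b , a ]³; and since [ b , a ]
-- commutes with b, the conjugate a⁻¹ba = b[ b , a ] has cube b³ [ b , a ]³,
-- whence b³ = 1 forces [ b , a ]³ = 1.

module Submission where

open import Defs
open import Algebra.Bundles using (Group; Monoid)
open import Data.Nat.Base using (zero; suc)
open import Data.Product.Base using (_,_)
open import Tactic.MonoidSolver using (solve)
import Algebra.Properties.Group as GroupProperties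
import Algebra.Properties.Monoid as MonoidProperties
import Algebra.Properties.Monoid.Mult as Mult
import Algebra.Properties.Semigroup as SemigroupProperties
import Relation.Binary.Reasoning.Setoid as SetoidReasoning

module _ {c ℓ} (M : Monoid c ℓ) where
  open Monoid M
  open Mult M using (_×_)
  open SemigroupProperties semigroup using (uv≈wx⇒u∙vy≈w∙xy)
  open SetoidReasoning setoid

  ×-commute : ∀ {x y} → x ∙ y ≈ y ∙ x → ∀ n → (n × x) ∙ y ≈ y ∙ (n × x)
  ×-commute {x} {y} xy≈yx zero = trans (identityˡ y) (sym (identityʳ y))
  ×-commute {x} {y} xy≈yx (suc n) = begin
    (x ∙ n × x) ∙ y  ≈⟨ assoc x (n × x) y ⟩
    x ∙ (n × x ∙ y)  ≈⟨ ∙-congˡ (×-commute xy≈yx n) ⟩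
    x ∙ (y ∙ n × x)  ≈⟨ uv≈wx⇒u∙vy≈w∙xy xy≈yx (n × x) ⟩
    y ∙ (x ∙ n × x)  ∎

  ×-distrib-∙ : ∀ {x y} → x ∙ y ≈ y ∙ x → ∀ n → n × (x ∙ y) ≈ (n × x) ∙ (n × y)
  ×-distrib-∙ {x} {y} xy≈yx zero = sym (identityˡ ε)
  ×-distrib-∙ {x} {y} xy≈yx (suc n) = begin
    (x ∙ y) ∙ n × (x ∙ y)      ≈⟨ ∙-congˡ (×-distrib-∙ xy≈yx n) ⟩
    (x ∙ y) ∙ (n × x ∙ n × y)  ≈⟨ solve M ⟩
    x ∙ (y ∙ n × x) ∙ n × y    ≈⟨ ∙-congʳ (∙-congˡ (×-commute xy≈yx n)) ⟨
    x ∙ (n × x ∙ y) ∙ n × y    ≈⟨ solve M ⟩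
    (x ∙ n × x) ∙ (y ∙ n × y)  ∎

  -- Collecting `x ∙ y ∙ x ∙ y ∙ x ∙ y` into `x`s followed by `y`s moves one `y` past two `x`s and
  -- another past one. Each of these three swaps releases one `d`, which can be carried to the right
  -- end; hence the exponent 3 on `d`. With `d` an atom of a monoid, the solver handles all the
  -- rebracketing.
  cube-∙-central : ∀ {x y d} → y ∙ x ≈ x ∙ y ∙ d → x ∙ d ≈ d ∙ x → y ∙ d ≈ d ∙ y →
                   3 × (x ∙ y) ≈ (3 × x) ∙ (3 × y) ∙ (3 × d)
  cube-∙-central {x} {y} {d} yx≈xyd xd≈dx yd≈dy = begin
    3 × (x ∙ y)                          ≈⟨ solve M ⟩
    -- The first two swaps act on disjoint factors, so they are made together.
    x ∙ (y ∙ x) ∙ (y ∙ x) ∙ y            ≈⟨ ∙-congʳ (∙-cong (∙-congˡ yx≈xyd) yx≈xyd) ⟩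
    x ∙ (x ∙ y ∙ d) ∙ (x ∙ y ∙ d) ∙ y    ≈⟨ solve M ⟩
    -- Carrying the left `d` past `x` brings the last out-of-order pair `y ∙ x` together.
    x ∙ x ∙ y ∙ (d ∙ x) ∙ y ∙ (d ∙ y)    ≈⟨ ∙-cong (∙-congʳ (∙-congˡ xd≈dx)) yd≈dy ⟨
    x ∙ x ∙ y ∙ (x ∙ d) ∙ y ∙ (y ∙ d)    ≈⟨ solve M ⟩
    x ∙ x ∙ (y ∙ x) ∙ (d ∙ (y ∙ y)) ∙ d  ≈⟨ ∙-congʳ (∙-cong (∙-congˡ yx≈xyd) d∙yy≈yy∙d) ⟩
    x ∙ x ∙ (x ∙ y ∙ d) ∙ (y ∙ y ∙ d) ∙ d ≈⟨ solve M ⟩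
    x ∙ x ∙ x ∙ y ∙ (d ∙ (y ∙ y)) ∙ d ∙ d ≈⟨ ∙-congʳ (∙-congʳ (∙-congˡ d∙yy≈yy∙d)) ⟩
    x ∙ x ∙ x ∙ y ∙ (y ∙ y ∙ d) ∙ d ∙ d  ≈⟨ solve M ⟩
    3 × x ∙ 3 × y ∙ 3 × d                ∎
    where
    d∙yy≈yy∙d : d ∙ (y ∙ y) ≈ y ∙ y ∙ d
    d∙yy≈yy∙d = begin
      d ∙ (y ∙ y)  ≈⟨ assoc d y y ⟨
      d ∙ y ∙ y    ≈⟨ ∙-congʳ yd≈dy ⟨
      y ∙ d ∙ y    ≈⟨ assoc y d y ⟩
      y ∙ (d ∙ y)  ≈⟨ ∙-congˡ yd≈dy ⟨
      y ∙ (y ∙ d)  ≈⟨ assoc y y d ⟨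
      y ∙ y ∙ d    ∎

module _ {c ℓ} (G : Group c ℓ) where
  open Group G
  open Mult monoid using (_×_; ×-congʳ)
  open GroupProperties G
  open MonoidProperties monoid using (cancelˡ; cancelʳ; cancelᶜ)
  open SetoidReasoning setoid

  swap-commutator : ∀ x y → y ∙ x ≈ x ∙ y ∙ [_,_] G y x
  swap-commutator x y = sym (begin
    x ∙ y ∙ (y ⁻¹ ∙ x ⁻¹ ∙ y ∙ x)      ≈⟨ solve monoid ⟩
    x ∙ (y ∙ (y ⁻¹ ∙ (x ⁻¹ ∙ y ∙ x)))  ≈⟨ ∙-congˡ (cancelˡ (inverseʳ y) _) ⟩
    x ∙ (x ⁻¹ ∙ y ∙ x)                 ≈⟨ ∙-congˡ (assoc (x ⁻¹) y x) ⟩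
    x ∙ (x ⁻¹ ∙ (y ∙ x))               ≈⟨ cancelˡ (inverseʳ x) _ ⟩
    y ∙ x                              ∎)

  commutator-trivial⇒commute : ∀ {x y} → [_,_] G y x ≈ ε → y ∙ x ≈ x ∙ y
  commutator-trivial⇒commute {x} {y} [y,x]≈ε = begin
    y ∙ x                   ≈⟨ swap-commutator x y ⟩
    x ∙ y ∙ [_,_] G y x     ≈⟨ ∙-congˡ [y,x]≈ε ⟩
    x ∙ y ∙ ε               ≈⟨ identityʳ _ ⟩
    x ∙ y                   ∎

  commute-⁻¹ : ∀ {x y} → x ∙ y ≈ y ∙ x → x ⁻¹ ∙ y ≈ y ∙ x ⁻¹
  commute-⁻¹ {x} {y} xy≈yx = begin
    x ⁻¹ ∙ y                ≈⟨ cancelʳ (inverseʳ x) _ ⟨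
    x ⁻¹ ∙ y ∙ x ∙ x ⁻¹     ≈⟨ ∙-congʳ (assoc (x ⁻¹) y x) ⟩
    x ⁻¹ ∙ (y ∙ x) ∙ x ⁻¹   ≈⟨ ∙-congʳ (∙-congˡ xy≈yx) ⟨
    x ⁻¹ ∙ (x ∙ y) ∙ x ⁻¹   ≈⟨ ∙-congʳ (cancelˡ (inverseˡ x) y) ⟩
    y ∙ x ⁻¹                ∎

  -- Swapping `y ∙ x` to `x ∙ y` and back returns to the start, so the two commutators released
  -- along the way multiply to `ε`.
  commutator-⁻¹ : ∀ x y → [_,_] G x y ⁻¹ ≈ [_,_] G y x
  commutator-⁻¹ x y = sym (inverseʳ-unique _ _ (∙-cancelˡ (y ∙ x) _ _ (begin
    y ∙ x ∙ ([_,_] G x y ∙ [_,_] G y x)  ≈⟨ assoc (y ∙ x) _ _ ⟨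
    y ∙ x ∙ [_,_] G x y ∙ [_,_] G y x    ≈⟨ ∙-congʳ (swap-commutator y x) ⟨
    x ∙ y ∙ [_,_] G y x                  ≈⟨ swap-commutator x y ⟨
    y ∙ x                                ≈⟨ identityʳ (y ∙ x) ⟨
    y ∙ x ∙ ε                            ∎)))

  ×-conjugate : ∀ x y n → n × (x ⁻¹ ∙ y ∙ x) ≈ x ⁻¹ ∙ (n × y) ∙ x
  ×-conjugate x y zero = begin
    ε             ≈⟨ inverseˡ x ⟨
    x ⁻¹ ∙ x      ≈⟨ ∙-congʳ (identityʳ (x ⁻¹)) ⟨
    x ⁻¹ ∙ ε ∙ x  ∎
  ×-conjugate x y (suc n) = begin
    x ⁻¹ ∙ y ∙ x ∙ n × (x ⁻¹ ∙ y ∙ x)      ≈⟨ ∙-congˡ (×-conjugate x y n) ⟩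
    x ⁻¹ ∙ y ∙ x ∙ (x ⁻¹ ∙ n × y ∙ x)      ≈⟨ ∙-congˡ (assoc (x ⁻¹) (n × y) x) ⟩
    x ⁻¹ ∙ y ∙ x ∙ (x ⁻¹ ∙ (n × y ∙ x))    ≈⟨ cancelᶜ (inverseʳ x) (x ⁻¹ ∙ y) _ ⟩
    x ⁻¹ ∙ y ∙ (n × y ∙ x)                 ≈⟨ solve monoid ⟩
    x ⁻¹ ∙ (y ∙ n × y) ∙ x                 ∎

  ×-⁻¹ : ∀ x n → n × (x ⁻¹) ≈ (n × x) ⁻¹
  ×-⁻¹ x n = inverseʳ-unique (n × x) (n × (x ⁻¹)) (begin
    n × x ∙ n × (x ⁻¹)  ≈⟨ ×-distrib-∙ monoid (trans (inverseʳ x) (sym (inverseˡ x))) n ⟨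
    n × (x ∙ x ⁻¹)      ≈⟨ ×-congʳ n (inverseʳ x) ⟩
    n × ε               ≈⟨ ×-ε n ⟩
    ε                   ∎)
    where
    ×-ε : ∀ n → n × ε ≈ ε
    ×-ε zero    = refl
    ×-ε (suc n) = trans (identityˡ (n × ε)) (×-ε n)

  ×-commutator-trivial : ∀ {x y} → y ∙ [_,_] G y x ≈ [_,_] G y x ∙ y →
                         ∀ n → n × y ≈ ε → n × [_,_] G y x ≈ ε
  ×-commutator-trivial {x} {y} comm n yⁿ≈ε = begin
    n × d                ≈⟨ identityˡ (n × d) ⟨
    -- The trivial power of `y` is inserted so that, `y` and `d` commuting, the product becomes a
    -- power of the single element `y ∙ d`, a conjugate of `y`.
    ε ∙ n × d            ≈⟨ ∙-congʳ yⁿ≈ε ⟨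
    n × y ∙ n × d        ≈⟨ ×-distrib-∙ monoid comm n ⟨
    n × (y ∙ d)          ≈⟨ ×-congʳ n yd≈x⁻¹yx ⟩
    n × (x ⁻¹ ∙ y ∙ x)   ≈⟨ ×-conjugate x y n ⟩
    x ⁻¹ ∙ n × y ∙ x     ≈⟨ ∙-congʳ (∙-congˡ yⁿ≈ε) ⟩
    x ⁻¹ ∙ ε ∙ x         ≈⟨ ∙-congʳ (identityʳ (x ⁻¹)) ⟩
    x ⁻¹ ∙ x             ≈⟨ inverseˡ x ⟩
    ε                    ∎
    where
    d = [_,_] G y x

    yd≈x⁻¹yx : y ∙ d ≈ x ⁻¹ ∙ y ∙ x
    yd≈x⁻¹yx = begin
      y ∙ (y ⁻¹ ∙ x ⁻¹ ∙ y ∙ x)      ≈⟨ solve monoid ⟩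
      y ∙ (y ⁻¹ ∙ (x ⁻¹ ∙ y ∙ x))    ≈⟨ cancelˡ (inverseʳ y) _ ⟩
      x ⁻¹ ∙ y ∙ x                   ∎

  module _ (engel : Is2Engel G) where

    commutator-commuteʳ : ∀ x y → x ∙ [_,_] G y x ≈ [_,_] G y x ∙ x
    commutator-commuteʳ x y = sym (commutator-trivial⇒commute (engel y x))

    -- The Engel law concerns only the second entry of a commutator. Exchanging the entries inverts
    -- the commutator, and an inverse commutes with whatever the element commutes with.
    commutator-commuteˡ : ∀ x y → y ∙ [_,_] G y x ≈ [_,_] G y x ∙ y
    commutator-commuteˡ x y = begin
      y ∙ [_,_] G y x       ≈⟨ ∙-congˡ (commutator-⁻¹ x y) ⟨
      y ∙ [_,_] G x y ⁻¹    ≈⟨ commute-⁻¹ (commutator-trivial⇒commute (engel x y)) ⟨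
      [_,_] G x y ⁻¹ ∙ y    ≈⟨ ∙-congʳ (commutator-⁻¹ x y) ⟩
      [_,_] G y x ∙ y       ∎

    -- Together with closure under inverses (`×-⁻¹`), this makes the elements of trivial cube a
    -- subgroup, so it is enough to write every element as a quotient of two of them.
    cube-∙-trivial : ∀ {x y} → 3 × x ≈ ε → 3 × y ≈ ε → 3 × (x ∙ y) ≈ ε
    cube-∙-trivial {x} {y} x³≈ε y³≈ε = begin
      3 × (x ∙ y)                      ≈⟨ cube-∙-central monoid (swap-commutator x y)
                                            (commutator-commuteʳ x y) yd≈dy ⟩
      3 × x ∙ 3 × y ∙ 3 × [_,_] G y x  ≈⟨ ∙-cong (∙-cong x³≈ε y³≈ε)
                                            (×-commutator-trivial yd≈dy 3 y³≈ε) ⟩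
      ε ∙ ε ∙ ε                        ≈⟨ solve monoid ⟩
      ε                                ∎
      where
      yd≈dy = commutator-commuteˡ x y

theorem4p4 : ∀ {c ℓ} (G : Group c ℓ) →
    Is2Engel G → Is2Large G (KilledBy G 3) → HasExponent G 3
theorem4p4 G engel large g with large g (Group.ε G)
-- The common point `z` of the two translates is both `g ∙ x` and `ε ∙ y`. The two factors of `g`
-- are therefore `y` and `x ⁻¹`.
... | z , (x , x³≈ε , z≈gx) , (y , y³≈ε , z≈εy) = begin
  3 × g           ≈⟨ ×-congʳ 3 g≈yx⁻¹ ⟩
  3 × (y ∙ x ⁻¹)  ≈⟨ cube-∙-trivial G engel y³≈ε x⁻³≈ε ⟩
  ε               ∎
  where
  open Group G
  open Mult monoid using (_×_; ×-congʳ)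
  open GroupProperties G
  open MonoidProperties monoid using (cancelʳ)
  open SetoidReasoning setoid

  g≈yx⁻¹ : g ≈ y ∙ x ⁻¹
  g≈yx⁻¹ = begin
    g             ≈⟨ cancelʳ (inverseʳ x) g ⟨
    g ∙ x ∙ x ⁻¹  ≈⟨ ∙-congʳ (trans (sym z≈gx) (trans z≈εy (identityˡ y))) ⟩
    y ∙ x ⁻¹      ∎

  x⁻³≈ε : 3 × (x ⁻¹) ≈ ε
  x⁻³≈ε = begin
    3 × (x ⁻¹)  ≈⟨ ×-⁻¹ G x 3 ⟩
    (3 × x) ⁻¹  ≈⟨ ⁻¹-cong x³≈ε ⟩
    ε ⁻¹        ≈⟨ ε⁻¹≈ε ⟩
    ε           ∎
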